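{- Let $\tilde L$ be a minimum-size counterexample. If $M$ is a nonempty set of meet-irreducible elements of $\tilde L$, then there exists a join-irreducible element $j$ of $\tilde L$ such that $|{\uparrow}j\cap M|>\frac{|M|}{2}$.
   Context: For a poset $P$, $x$ upper covers $y$ (and $y$ lower covers $x$) if $y<x$ with nothing strictly between. Join-irreducible: upper covers exactly one element; meet-irreducible: lower covers exactly one element. For $x\in P$, ${\uparrow}x=\{y\in P: x\le y\}$. A counterexample is a finite lattice $L$ with $|L|>1$ in which every join-irreducible $j$ satisfies $|{\uparrow}j|>|L|/2$; a minimum-size counterexample is a counterexample $\tilde L$ such that no counterexample has fewer elements. -}

module Defs where

open import Data.Fin.Base using (Fin)
open import Data.Fin.Properties using (inj⇒≟)
open import Data.Nat.Base using (ℕ; _<_; _*_)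
open import Data.Product using (∃!; ∃; _×_)
open import Data.Vec.Base using (count; tabulate)
open import Function.Base using (flip)
open import Function.Bundles using (Inverse)
open import Function.Properties.Inverse using (Inverse⇒Injection)
open import Level using (Level; _⊔_; suc)
open import Relation.Binary.Core using (Rel)
open import Relation.Binary.Definitions using () renaming (Decidable to Decidable₂)
open import Relation.Binary.Lattice using (Lattice)
import Relation.Binary.Lattice.Properties.MeetSemilattice as MeetProperties
import Relation.Binary.Properties.Poset as PosetProperties
open import Relation.Binary.PropositionalEquality using (setoid)
open import Relation.Nullary.Negation using (¬_)
open import Relation.Unary using (Pred; Decidable)

-- The enumeration is a bijection up to _≈_, so size is the number of
-- elements of the lattice counted up to its own equality.
record FiniteLattice (c ℓ₁ ℓ₂ : Level) : Set (suc (c ⊔ ℓ₁ ⊔ ℓ₂)) where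
  field
    lattice     : Lattice c ℓ₁ ℓ₂
    size        : ℕ
    enumeration : Inverse (Lattice.setoid lattice) (setoid (Fin size))

  open Lattice lattice public renaming (setoid to ≈-setoid)
  open PosetProperties poset public using () renaming (_<_ to _≺_)

  _≟_ : Decidable₂ _≈_
  _≟_ = inj⇒≟ (Inverse⇒Injection enumeration)

  _≤?_ : Decidable₂ _≤_
  _≤?_ = MeetProperties.≈-dec⇒≤-dec meetSemilattice _≟_

  -- For a predicate respecting _≈_, the cardinality of the subset it defines.
  card : ∀ {p} {P : Pred Carrier p} → Decidable P → ℕ
  card P? = count P? (tabulate (Inverse.from enumeration))

  UpperCovers : Rel Carrier (c ⊔ ℓ₁ ⊔ ℓ₂)
  UpperCovers x y = (y ≺ x) × ¬ (∃ λ z → (y ≺ z) × (z ≺ x))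

  LowerCovers : Rel Carrier (c ⊔ ℓ₁ ⊔ ℓ₂)
  LowerCovers = flip UpperCovers

  JoinIrreducible : Pred Carrier (c ⊔ ℓ₁ ⊔ ℓ₂)
  JoinIrreducible x = ∃! _≈_ (UpperCovers x)

  MeetIrreducible : Pred Carrier (c ⊔ ℓ₁ ⊔ ℓ₂)
  MeetIrreducible x = ∃! _≈_ (LowerCovers x)

  ↑ : Carrier → Pred Carrier ℓ₂
  ↑ x y = x ≤ y

  ↑? : ∀ x → Decidable (↑ x)
  ↑? x y = x ≤? y

module _ {c ℓ₁ ℓ₂ : Level} where

  -- Here and below, a > b / 2 is written b < 2 * a.
  Counterexample : Pred (FiniteLattice c ℓ₁ ℓ₂) (c ⊔ ℓ₁ ⊔ ℓ₂)
  Counterexample L = (1 < size) × (∀ j → JoinIrreducible j → size < 2 * card (↑? j))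
    where open FiniteLattice L

  -- Comparing only with lattices at the same universe levels loses nothing:
  -- every finite lattice has an isomorphic copy at any levels.
  MinimumCounterexample : Pred (FiniteLattice c ℓ₁ ℓ₂) (suc (c ⊔ ℓ₁ ⊔ ℓ₂))
  MinimumCounterexample L =
    Counterexample L × ¬ (∃ λ K → Counterexample K × (FiniteLattice.size K < FiniteLattice.size L))

{-# OPTIONS --safe #-}
-- Put K = L ∖ M.  A meet-irreducible element is not the meet of two larger
-- ones, so K is closed under meets; every element lies below a least element
-- of K, so K is a lattice, smaller than L.  A join-irreducible j′ of K, with
-- lower cover p in K, comes from a join-irreducible j of L: any j ≤ j′ with
-- j ≰ p satisfies ↑ j ∩ K ⊆ ↑ j′.  If no join-irreducible of L lay below
-- more than half of M, then |↑ j′ ∩ K| ≥ |↑ j| − |↑ j ∩ M| > |L|/2 − |M|/2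
-- = |K|/2, so K would be a smaller counterexample.  The exception |K| = 1
-- is excluded because L is then a chain, whose top is join-irreducible.
module Submission where

open import Defs
open import Data.Bool.Base using (true; false)
open import Data.Fin.Base using (Fin; zero; suc; toℕ)
open import Data.Fin.Induction using (spo-wellFounded; spo-noetherian)
open import Data.Fin.Properties using (any?; injective⇒≤; toℕ<n; toℕ-injective; suc-injective)
open import Data.Nat.Base using (ℕ; suc; z≤n; s≤s⁻¹; _<_; _*_; _+_) renaming (_≤_ to _≤ⁿ_)
import Data.Nat.Properties as ℕ
open import Data.Product using (∃; _×_; _,_; proj₁; proj₂; map)
open import Data.Sum using (_⊎_; inj₁; inj₂)
open import Data.Vec.Base using (Vec; []; _∷_; count; tabulate)
open import Function.Base using (_∘_; id; flip; _on_)
open import Function.Bundles using (Inverse)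
open import Induction.WellFounded using (WellFounded; Acc; acc; module Subrelation)
open import Level using (Level; _⊔_)
open import Relation.Binary.Core using (Rel)
open import Relation.Binary.Definitions using (_Respects_; _Respectsˡ_) renaming (Decidable to Decidable₂)
open import Relation.Binary.Lattice using (Lattice)
import Relation.Binary.Construct.NonStrictToStrict as ToStrict
import Relation.Binary.Construct.On as On
import Relation.Binary.Properties.Poset as PosetProperties
open import Relation.Binary.PropositionalEquality using (_≡_; refl; sym; trans; cong; subst)
open import Relation.Nullary.Decidable using (Dec; yes; no; does; map′; False; toWitnessFalse; fromWitnessFalse; decidable-stable; ¬?; _×-dec_)
open import Relation.Nullary.Negation using (¬_; contradiction)
open import Relation.Unary using (Pred; Decidable; Satisfiable; ∁; _∩_; _⊆_)
open import Relation.Unary.Properties using (_∩?_; ∁?)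

-- Counting and numbering the members of a decidable subset.

module _ {a p} {A : Set a} {P : Pred A p} (P? : Decidable P) where

  count-∁ : ∀ {n} (xs : Vec A n) → count P? xs + count (∁? P?) xs ≡ n
  count-∁ [] = refl
  count-∁ (x ∷ xs) with does (P? x)
  ... | true  = cong suc (count-∁ xs)
  ... | false = trans (ℕ.+-suc _ _) (cong suc (count-∁ xs))

  count-∩-∁ : ∀ {q} {Q : Pred A q} (Q? : Decidable Q) {n} (xs : Vec A n) →
              count P? xs ≡ count (P? ∩? Q?) xs + count (P? ∩? ∁? Q?) xs
  count-∩-∁ Q? [] = refl
  count-∩-∁ Q? (x ∷ xs) with does (P? x) | does (Q? x)
  ... | false | _     = count-∩-∁ Q? xs
  ... | true  | true  = cong suc (count-∩-∁ Q? xs)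
  ... | true  | false = trans (cong suc (count-∩-∁ Q? xs)) (sym (ℕ.+-suc _ _))

  -- Together with `locate`, this numbers the indices whose value satisfies `P`. Proofs of `P` need
  -- not be unique, so the inverse and injectivity laws compare indices only.
  select : ∀ {n} (f : Fin n → A) → Fin (count P? (tabulate f)) → ∃ (P ∘ f)
  select {suc n} f k with P? (f zero)
  select {suc n} f zero    | yes p = zero , p
  select {suc n} f (suc k) | yes _ = map suc id (select (f ∘ suc) k)
  select {suc n} f k       | no _  = map suc id (select (f ∘ suc) k)

  locate : ∀ {n} (f : Fin n → A) i → P (f i) → Fin (count P? (tabulate f))
  locate f zero p with P? (f zero)
  ... | yes _ = zero
  ... | no ¬p = contradiction p ¬p
  locate f (suc i) p with P? (f zero)
  ... | yes _ = suc (locate (f ∘ suc) i p)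
  ... | no _  = locate (f ∘ suc) i p

  select-locate : ∀ {n} (f : Fin n → A) i (p : P (f i)) → proj₁ (select f (locate f i p)) ≡ i
  select-locate f zero p with P? (f zero)
  ... | yes _ = refl
  ... | no ¬p = contradiction p ¬p
  select-locate f (suc i) p with P? (f zero)
  ... | yes _ = cong suc (select-locate (f ∘ suc) i p)
  ... | no _  = cong suc (select-locate (f ∘ suc) i p)

  select-injective : ∀ {n} (f : Fin n → A) k l → proj₁ (select f k) ≡ proj₁ (select f l) → k ≡ l
  select-injective {suc n} f k l eq with P? (f zero)
  select-injective {suc n} f zero    zero    eq | yes _ = refl
  select-injective {suc n} f (suc k) (suc l) eq | yes _ =
    cong suc (select-injective (f ∘ suc) k l (suc-injective eq))
  select-injective {suc n} f k       l       eq | no _  =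
    select-injective (f ∘ suc) k l (suc-injective eq)

  locate-cong : ∀ {n} (f : Fin n → A) {i j} (p : P (f i)) (q : P (f j)) → i ≡ j →
                locate f i p ≡ locate f j q
  locate-cong f p q eq = select-injective f _ _
    (trans (select-locate f _ p) (trans eq (sym (select-locate f _ q))))

  locate-select : ∀ {n} (f : Fin n → A) k → let i , p = select f k in locate f i p ≡ k
  locate-select f k = select-injective f _ k (select-locate f _ _)

  locate-injective : ∀ {n} (f : Fin n → A) {i j} (p : P (f i)) (q : P (f j)) →
                     locate f i p ≡ locate f j q → i ≡ j
  locate-injective f p q eq =
    trans (sym (select-locate f _ p)) (trans (cong (proj₁ ∘ select f) eq) (select-locate f _ q))

-- Search and extremal elements in a finite lattice.

module FiniteLatticeProperties {c ℓ₁ ℓ₂} (L : FiniteLattice c ℓ₁ ℓ₂) where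
  open FiniteLattice L renaming (refl to ≤-refl; trans to ≤-trans)
  open Inverse enumeration using (to; from; strictlyInverseʳ; inverseʳ)
  open PosetProperties poset using (<-isStrictPartialOrder; <-respˡ-≈; <-respʳ-≈; ≤∧≉⇒<; <⇒≱)

  size≤1⇒≈ : size ≤ⁿ 1 → ∀ x y → x ≈ y
  size≤1⇒≈ size≤1 x y = Eq.trans (Eq.sym (strictlyInverseʳ x))
    (inverseʳ (toℕ-injective (trans (toℕ≡0 (to x)) (sym (toℕ≡0 (to y))))))
    where
    toℕ≡0 : ∀ i → toℕ i ≡ 0
    toℕ≡0 i = ℕ.n<1⇒n≡0 (ℕ.<-≤-trans (toℕ<n i) size≤1)

  _≺?_ : Decidable₂ _≺_
  _≺?_ = ToStrict.<-decidable _≈_ _≤_ _≟_ _≤?_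

  -- Strict partial orders on `Fin size` are well founded, and `to` carries `_≺_` into one of them
  -- because `from (to x) ≈ x`.
  ≺-wellFounded : WellFounded _≺_
  ≺-wellFounded = Subrelation.wellFounded
    (λ x≺y → <-respˡ-≈ (Eq.sym (strictlyInverseʳ _)) (<-respʳ-≈ (Eq.sym (strictlyInverseʳ _)) x≺y))
    (On.wellFounded to (spo-wellFounded (On.isStrictPartialOrder from <-isStrictPartialOrder)))

  ≺-noetherian : WellFounded (flip _≺_)
  ≺-noetherian = Subrelation.wellFounded
    (λ x≺y → <-respˡ-≈ (Eq.sym (strictlyInverseʳ _)) (<-respʳ-≈ (Eq.sym (strictlyInverseʳ _)) x≺y))
    (On.wellFounded to (spo-noetherian (On.isStrictPartialOrder from <-isStrictPartialOrder)))

  satisfiable? : ∀ {q} {Q : Pred Carrier q} → Decidable Q → Q Respects _≈_ → Dec (∃ Q)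
  satisfiable? Q? Q-resp = map′
    (λ (i , q) → from i , q)
    (λ (x , q) → to x , Q-resp (Eq.sym (strictlyInverseʳ x)) q)
    (any? (Q? ∘ from))

  -- Descend as long as the search finds a smaller element of `Q`. Keeping the relation abstract
  -- lets the same descent give minimal and maximal elements.
  ⊏-minimal : ∀ {r q} {_⊏_ : Rel Carrier r} {Q : Pred Carrier q} →
              WellFounded _⊏_ → Decidable₂ _⊏_ → _⊏_ Respectsˡ _≈_ →
              Decidable Q → Q Respects _≈_ →
              ∀ {x} → Q x → ∃ λ y → Q y × (∀ {z} → Q z → ¬ (z ⊏ y))
  ⊏-minimal {_⊏_ = _⊏_} {Q} wf _⊏?_ ⊏-respˡ Q? Q-resp {x} = go (wf x)
    where
    go : ∀ {x} → Acc _⊏_ x → Q x → ∃ λ y → Q y × (∀ {z} → Q z → ¬ (z ⊏ y))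
    go {x} (acc rec) q
      with satisfiable? (λ z → Q? z ×-dec (z ⊏? x)) (λ e (q , r) → Q-resp e q , ⊏-respˡ e r)
    ... | yes (z , q′ , z⊏x) = go (rec z⊏x) q′
    ... | no none            = x , q , λ q′ z⊏x → none (_ , q′ , z⊏x)

  module _ {q} {Q : Pred Carrier q} (Q? : Decidable Q) (Q-resp : Q Respects _≈_) where

    minimal : ∀ {x} → Q x → ∃ λ y → Q y × (∀ {z} → Q z → ¬ (z ≺ y))
    minimal = ⊏-minimal ≺-wellFounded _≺?_ <-respˡ-≈ Q? Q-resp

    maximal : ∀ {x} → Q x → ∃ λ y → Q y × (∀ {z} → Q z → ¬ (y ≺ z))
    maximal = ⊏-minimal ≺-noetherian (flip _≺?_) <-respʳ-≈ Q? Q-resp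

  -- Covers and irreducible elements.

  lowerCover : ∀ {x z} → z ≺ x → ∃ λ u → z ≤ u × UpperCovers x u
  lowerCover {x} {z} z≺x
    with maximal (λ u → (z ≤? u) ×-dec (u ≺? x))
                 (λ e (p , q) → ≤-respʳ-≈ e p , <-respˡ-≈ e q) (≤-refl , z≺x)
  ... | u , (z≤u , u≺x) , max =
    u , z≤u , u≺x , λ (w , u≺w , w≺x) → max (≤-trans z≤u (proj₁ u≺w) , w≺x) u≺w

  upperCover : ∀ {x z} → x ≺ z → ∃ λ u → u ≤ z × LowerCovers x u
  upperCover {x} {z} x≺z
    with minimal (λ u → (u ≤? z) ×-dec (x ≺? u))
                 (λ e (p , q) → ≤-respˡ-≈ e p , <-respʳ-≈ e q) (≤-refl , x≺z)
  ... | u , (u≤z , x≺u) , min =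
    u , u≤z , x≺u , λ (w , x≺w , w≺u) → min (≤-trans (proj₁ w≺u) u≤z , x≺w) w≺u

  -- Existence of such an `m` is equivalent to join-irreducibility of `x`, but it avoids covers and
  -- is easier to use and to decide.
  LargestBelow : Rel Carrier (c ⊔ ℓ₁ ⊔ ℓ₂)
  LargestBelow x m = m ≺ x × (∀ {z} → z ≺ x → z ≤ m)

  -- By finiteness, anything strictly below `x` lies under some lower cover of `x`, and there is
  -- only one.
  joinIrreducible⇒largestBelow : ∀ {x} → JoinIrreducible x → ∃ (LargestBelow x)
  joinIrreducible⇒largestBelow (m , (m≺x , _) , unique) = m , m≺x , λ z≺x →
    let u , z≤u , covers = lowerCover z≺x in ≤-respʳ-≈ (Eq.sym (unique covers)) z≤u

  largestBelow⇒joinIrreducible : ∀ {x} → ∃ (LargestBelow x) → JoinIrreducible x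
  largestBelow⇒joinIrreducible {x} (m , m≺x , largest) =
    m , (m≺x , λ (z , m≺z , z≺x) → <⇒≱ m≺z (largest z≺x)) , unique
    where
    unique : ∀ {y} → UpperCovers x y → m ≈ y
    unique {y} (y≺x , gap) with m ≟ y
    ... | yes m≈y = m≈y
    ... | no  m≉y =
      contradiction (m , ≤∧≉⇒< (largest y≺x) (m≉y ∘ Eq.sym) , m≺x) gap

  -- The universal clause is decided by searching for a violation; decidability of `_≤_` then
  -- removes the double negation.
  largestBelow? : ∀ x m → Dec (LargestBelow x m)
  largestBelow? x m = map′
    (λ (m≺x , none) → m≺x , λ {z} z≺x →
      decidable-stable (z ≤? m) (λ z≰m → none (z , z≺x , z≰m)))
    (λ (m≺x , largest) → m≺x , λ (z , z≺x , z≰m) → z≰m (largest z≺x))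
    ((m ≺? x) ×-dec ¬? (satisfiable? (λ z → (z ≺? x) ×-dec ¬? (z ≤? m))
      (λ e (p , q) → <-respˡ-≈ e p , q ∘ ≤-respˡ-≈ (Eq.sym e))))

  joinIrreducible? : Decidable JoinIrreducible
  joinIrreducible? x = map′ largestBelow⇒joinIrreducible joinIrreducible⇒largestBelow
    (satisfiable? (largestBelow? x)
      (λ e (p , largest) → <-respˡ-≈ e p , λ z≺x → ≤-respʳ-≈ e (largest z≺x)))

  joinIrreducible-resp : JoinIrreducible Respects _≈_
  joinIrreducible-resp e ji with joinIrreducible⇒largestBelow ji
  ... | m , m≺x , largest = largestBelow⇒joinIrreducible
    (m , <-respʳ-≈ e m≺x , λ z≺y → largest (<-respʳ-≈ (Eq.sym e) z≺y))

  meetIrreducible⇒leastAbove : ∀ {x} → MeetIrreducible x → ∃ λ s → x ≺ s × (∀ {z} → x ≺ z → s ≤ z)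
  meetIrreducible⇒leastAbove (s , (x≺s , _) , unique) = s , x≺s , λ x≺z →
    let u , u≤z , covers = upperCover x≺z in ≤-respˡ-≈ (Eq.sym (unique covers)) u≤z

  -- Otherwise `x` and `y` both lie strictly above `x ∧ y`, hence above the least element `s`
  -- strictly above it, so `s ≤ x ∧ y`, which is absurd.
  meetIrreducible-∧ : ∀ {x y} → MeetIrreducible (x ∧ y) → x ∧ y ≈ x ⊎ x ∧ y ≈ y
  meetIrreducible-∧ {x} {y} mi with (x ∧ y) ≟ x | (x ∧ y) ≟ y
  ... | yes e | _     = inj₁ e
  ... | no  _ | yes e = inj₂ e
  ... | no ≉x | no ≉y with meetIrreducible⇒leastAbove mi
  ...   | s , x∧y≺s , least = contradiction
    (∧-greatest (least (≤∧≉⇒< (x∧y≤x x y) ≉x)) (least (≤∧≉⇒< (x∧y≤y x y) ≉y)))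
    (<⇒≱ x∧y≺s)

  -- A minimal element of {z | z ≤ x, z ≰ y} has j ∧ y as its only lower cover.
  joinIrreducible-separates : ∀ {x y} → ¬ (x ≤ y) → ∃ λ j → JoinIrreducible j × j ≤ x × ¬ (j ≤ y)
  joinIrreducible-separates {x} {y} x≰y
    with minimal (λ z → (z ≤? x) ×-dec ¬? (z ≤? y))
                 (λ e (p , q) → ≤-respˡ-≈ e p , q ∘ ≤-respˡ-≈ (Eq.sym e)) (≤-refl , x≰y)
  ... | j , (j≤x , j≰y) , min = j , largestBelow⇒joinIrreducible (j ∧ y , j∧y≺j , largest) , j≤x , j≰y
    where
    j∧y≺j : (j ∧ y) ≺ j
    j∧y≺j = x∧y≤x j y , λ e → j≰y (≤-respˡ-≈ e (x∧y≤y j y))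
    largest : ∀ {z} → z ≺ j → z ≤ j ∧ y
    largest {z} z≺j with z ≤? y
    ... | yes z≤y = ∧-greatest (proj₁ z≺j) z≤y
    ... | no  z≰y = contradiction z≺j (min (≤-trans (proj₁ z≺j) j≤x , z≰y))

-- Comparing cardinalities by injections.

module _ {c ℓ₁ ℓ₂ c′ ℓ₁′ ℓ₂′} (K : FiniteLattice c ℓ₁ ℓ₂) (L : FiniteLattice c′ ℓ₁′ ℓ₂′) where
  private
    module K = FiniteLattice K
    module L = FiniteLattice L
    module enumK = Inverse K.enumeration
    module enumL = Inverse L.enumeration

  -- The map `h` receives the proof of `P` along with the element, as is needed to map into a
  -- sublattice whose elements carry proofs. Injectivity concerns the elements alone.
  card-injection : ∀ {p q} {P : Pred K.Carrier p} {Q : Pred L.Carrier q}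
                   (P? : Decidable P) (Q? : Decidable Q) → Q Respects L._≈_ →
                   (h : ∃ P → L.Carrier) → (∀ x → Q (h x)) →
                   (∀ {x y} → h x L.≈ h y → proj₁ x K.≈ proj₁ y) →
                   K.card P? ≤ⁿ L.card Q?
  card-injection {P = P} {Q} P? Q? Q-resp h Qh h-inj = injective⇒≤ {f = φ} φ-inj
    where
    element : Fin (K.card P?) → ∃ P
    element k = let i , p = select P? enumK.from k in enumK.from i , p
    Q-element : ∀ k → Q (enumL.from (enumL.to (h (element k))))
    Q-element k = Q-resp (L.Eq.sym (enumL.strictlyInverseʳ _)) (Qh (element k))
    φ : Fin (K.card P?) → Fin (L.card Q?)
    φ k = locate Q? enumL.from (enumL.to (h (element k))) (Q-element k)
    φ-inj : ∀ {k l} → φ k ≡ φ l → k ≡ l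
    φ-inj {k} {l} eq = select-injective P? enumK.from k l
      (from-injective (h-inj (to-injective (locate-injective Q? enumL.from (Q-element k) (Q-element l) eq))))
      where
      to-injective : ∀ {x y} → enumL.to x ≡ enumL.to y → x L.≈ y
      to-injective e = L.Eq.trans (L.Eq.sym (enumL.strictlyInverseʳ _)) (enumL.inverseʳ e)
      from-injective : ∀ {i j} → enumK.from i K.≈ enumK.from j → i ≡ j
      from-injective e = trans (sym (enumK.strictlyInverseˡ _)) (enumK.inverseˡ e)

module _ {c ℓ₁ ℓ₂} (L : FiniteLattice c ℓ₁ ℓ₂) where
  open FiniteLattice L

  card-mono : ∀ {p q} {P : Pred Carrier p} {Q : Pred Carrier q} (P? : Decidable P) (Q? : Decidable Q) →
              Q Respects _≈_ → P ⊆ Q → card P? ≤ⁿ card Q?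
  card-mono P? Q? Q-resp P⊆Q = card-injection L L P? Q? Q-resp proj₁ (λ (_ , p) → P⊆Q p) (λ e → e)

-- The lattice left after removing meet-irreducible elements.

module Removal {c ℓ₁ ℓ₂ p} (L : FiniteLattice c ℓ₁ ℓ₂) {M : Pred (FiniteLattice.Carrier L) p}
               (M? : Decidable M) (M-resp : M Respects (FiniteLattice._≈_ L))
               (M⊆MI : M ⊆ FiniteLattice.MeetIrreducible L) where
  open FiniteLattice L renaming (refl to ≤-refl; trans to ≤-trans)
  open FiniteLatticeProperties L
  open Inverse enumeration using (to; from; to-cong; strictlyInverseˡ; strictlyInverseʳ; inverseʳ)

  ∁M-resp : ∁ M Respects _≈_
  ∁M-resp e ¬m = ¬m ∘ M-resp (Eq.sym e)

  ∁M-∧ : ∀ {x y} → ¬ M x → ¬ M y → ¬ M (x ∧ y)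
  ∁M-∧ ¬mx ¬my m with meetIrreducible-∧ (M⊆MI m)
  ... | inj₁ e = ¬mx (M-resp e m)
  ... | inj₂ e = ¬my (M-resp e m)

  -- Climb from `x` while in `M`: an element outside `M` above `x` is strictly above it, hence above
  -- the least element `s` strictly above `x`. So passing to `s` loses no candidate.
  closure : ∀ x → ∃ λ y → ¬ M y × x ≤ y × (∀ {z} → ¬ M z → x ≤ z → y ≤ z)
  closure x = go (≺-noetherian x)
    where
    go : ∀ {x} → Acc (flip _≺_) x → ∃ λ y → ¬ M y × x ≤ y × (∀ {z} → ¬ M z → x ≤ z → y ≤ z)
    go {x} (acc rec) with M? x
    ... | no ¬m = x , ¬m , ≤-refl , λ _ x≤z → x≤z
    ... | yes m with meetIrreducible⇒leastAbove (M⊆MI m)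
    ...   | s , x≺s , least with go (rec x≺s)
    ...     | y , ¬my , s≤y , y-least =
      y , ¬my , ≤-trans (proj₁ x≺s) s≤y ,
      λ ¬mz x≤z → y-least ¬mz (least (x≤z , λ e → ¬mz (M-resp e m)))

  -- False (M? x) rather than ¬ M x, as the latter lives at the level of M.
  Remaining : Set c
  Remaining = ∃ λ x → False (M? x)

  remaining : ∃ (∁ M) → Remaining
  remaining (x , ¬m) = x , fromWitnessFalse ¬m

  remaining⇒∁M : (x : Remaining) → ¬ M (proj₁ x)
  remaining⇒∁M (_ , ¬m) = toWitnessFalse ¬m

  -- Meets are inherited from `L`; joins must be closed, since `x ∨ y` may lie in `M`.
  lattice∖M : Lattice c ℓ₁ ℓ₂
  lattice∖M = record
    { Carrier   = Remaining
    ; _≈_       = _≈_ on proj₁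
    ; _≤_       = _≤_ on proj₁
    ; _∨_       = λ (x , _) (y , _) → let z , ¬m , _ = closure (x ∨ y) in remaining (z , ¬m)
    ; _∧_       = λ x y → remaining (proj₁ x ∧ proj₁ y , ∁M-∧ (remaining⇒∁M x) (remaining⇒∁M y))
    ; isLattice = record
      { isPartialOrder = On.isPartialOrder proj₁ isPartialOrder
      ; supremum = λ (x , _) (y , _) → let _ , _ , x∨y≤z , least = closure (x ∨ y) in
          ≤-trans (x≤x∨y x y) x∨y≤z ,
          ≤-trans (y≤x∨y x y) x∨y≤z ,
          λ w x≤w y≤w → least (remaining⇒∁M w) (∨-least x≤w y≤w)
      ; infimum = λ (x , _) (y , _) → x∧y≤x x y , x∧y≤y x y , λ _ → ∧-greatest
      }
    }

  L∖M : FiniteLattice c ℓ₁ ℓ₂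
  L∖M = record
    { lattice     = lattice∖M
    ; size        = card (∁? M?)
    ; enumeration = record
      { to        = index
      ; from      = element
      ; to-cong   = λ {x} {y} e → index-cong x y (to-cong e)
      ; from-cong = λ { refl → Eq.refl }
      ; inverse   = (λ {k} {x} e → trans (index-cong x (element k) (to-cong e)) (index-element k))
                  , λ { {x} refl → element-index x }
      }
    }
    where
    to-∁M : (x : Remaining) → ¬ M (from (to (proj₁ x)))
    to-∁M x = ∁M-resp (Eq.sym (strictlyInverseʳ _)) (remaining⇒∁M x)
    index : Remaining → Fin (card (∁? M?))
    index x = locate (∁? M?) from (to (proj₁ x)) (to-∁M x)
    element : Fin (card (∁? M?)) → Remaining
    element k = let i , ¬m = select (∁? M?) from k in remaining (from i , ¬m)
    index-cong : ∀ x y → to (proj₁ x) ≡ to (proj₁ y) → index x ≡ index y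
    index-cong x y = locate-cong (∁? M?) from (to-∁M x) (to-∁M y)
    index-element : ∀ k → index (element k) ≡ k
    index-element k = trans
      (locate-cong (∁? M?) from (to-∁M (element k)) (proj₂ (select (∁? M?) from k)) (strictlyInverseˡ _))
      (locate-select (∁? M?) from k)
    element-index : ∀ x → proj₁ (element (index x)) ≈ proj₁ x
    element-index x = inverseʳ (select-locate (∁? M?) from (to (proj₁ x)) (to-∁M x))

  private
    module K = FiniteLattice L∖M
    module K-properties = FiniteLatticeProperties L∖M

  -- Let `p` be the largest remaining element strictly below `j′`, and choose `j ≤ j′` with `j ≰ p`.
  -- If a remaining `x ≥ j` were not above `j′`, then `x ∧ j′` would remain and lie strictly below
  -- `j′`, so `j ≤ x ∧ j′ ≤ p`.
  joinIrreducible-lift : ∀ {j′} → K.JoinIrreducible j′ →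
                         ∃ λ j → JoinIrreducible j × (↑ j ∩ ∁ M ⊆ ↑ (proj₁ j′))
  joinIrreducible-lift {j′ , ¬f} ji with K-properties.joinIrreducible⇒largestBelow {j′ , ¬f} ji
  ... | (p , _) , p≺j′ , largest
    with joinIrreducible-separates (PosetProperties.<⇒≱ poset p≺j′)
  ...   | j , jij , j≤j′ , j≰p = j , jij , above
    where
    above : ↑ j ∩ ∁ M ⊆ ↑ j′
    above {x} (j≤x , ¬mx) with (x ∧ j′) ≟ j′
    ... | yes e = ≤-respˡ-≈ e (x∧y≤x x j′)
    ... | no ≉j′ = contradiction
      (≤-trans (∧-greatest j≤x j≤j′)
        (largest {remaining (x ∧ j′ , ∁M-∧ ¬mx (toWitnessFalse ¬f))} (x∧y≤y x j′ , ≉j′)))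
      j≰p

  -- The case of a single remaining element.

  ≤-unique : ∀ {t} → (∀ {x} → ¬ M x → x ≈ t) → ∀ z → z ≤ t
  ≤-unique unique z = let _ , ¬m , z≤y , _ = closure z in ≤-respʳ-≈ (unique ¬m) z≤y

  -- Elements other than t are meet-irreducible, so they form a chain, and a
  -- maximal one of them is the largest element below t.
  joinIrreducible-unique : ∀ {t} → ¬ M t → (∀ {x} → ¬ M x → x ≈ t) → Satisfiable M →
                           JoinIrreducible t
  joinIrreducible-unique {t} ¬mt unique (x , m)
    with maximal (λ z → ¬? (z ≟ t)) (λ e ≉t → ≉t ∘ Eq.trans e) {x} (λ e → ¬mt (M-resp e m))
  ... | y , y≉t , max = largestBelow⇒joinIrreducible (y , (≤-unique unique y , y≉t) , largest)
    where
    largest : ∀ {z} → z ≺ t → z ≤ y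
    largest {z} (_ , z≉t) with M? (z ∧ y)
    ... | no ¬m = contradiction (antisym (≤-unique unique y) (≤-respˡ-≈ (unique ¬m) (x∧y≤y z y))) y≉t
    ... | yes m with meetIrreducible-∧ (M⊆MI m)
    ...   | inj₁ e = ≤-respˡ-≈ e (x∧y≤y z y)
    ...   | inj₂ e with y ≟ z
    ...     | yes y≈z = reflexive (Eq.sym y≈z)
    ...     | no  y≉z = contradiction (≤-respˡ-≈ e (x∧y≤x z y) , y≉z) (max z≉t)

  -- Sizes, and the counterexample property of the remaining lattice.

  card-M+card-∁M : card M? + K.size ≡ size
  card-M+card-∁M = count-∁ M? (tabulate from)

  0<card-M : Satisfiable M → 0 < card M?
  0<card-M (x , m) = ℕ.≤-<-trans z≤n
    (toℕ<n (locate M? from (to x) (M-resp (Eq.sym (strictlyInverseʳ x)) m)))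

  card-∁M<size : Satisfiable M → K.size < size
  card-∁M<size sat = subst (K.size <_) card-M+card-∁M (ℕ.m<n+m K.size (0<card-M sat))

  1<card-∁M : Counterexample L → Satisfiable M → 1 < K.size
  1<card-∁M (1<size , large) (x , m) = ℕ.≰⇒> λ size≤1 →
    -- The closure serves only to produce an element outside `M`.
    let t , ¬mt , _ = closure x

        unique : ∀ {y} → ¬ M y → y ≈ t
        unique ¬my = K-properties.size≤1⇒≈ size≤1 (remaining (_ , ¬my)) (remaining (t , ¬mt))

        ↑t⊆∁M : ↑ t ⊆ ∁ M
        ↑t⊆∁M t≤y my = ¬mt (M-resp (antisym (≤-unique unique _) t≤y) my)

        card-↑t≤1 : card (↑? t) ≤ⁿ 1
        card-↑t≤1 = ℕ.≤-trans (card-mono L (↑? t) (∁? M?) ∁M-resp ↑t⊆∁M) size≤1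
    -- Join-irreducibility of `t` gives `size < 2 * 1`, against `1 < size`.
    in ℕ.<⇒≱ 1<size (s≤s⁻¹ (ℕ.<-≤-trans
         (large t (joinIrreducible-unique ¬mt unique (x , m)))
         (ℕ.*-monoʳ-≤ 2 card-↑t≤1)))

  L∖M-counterexample : Counterexample L → Satisfiable M →
                       (∀ j → JoinIrreducible j → 2 * card (↑? j ∩? M?) ≤ⁿ card M?) →
                       Counterexample L∖M
  L∖M-counterexample ce sat small = 1<card-∁M ce sat , λ j′ ji →
    let j , jij , ↑j∩∁M⊆↑j′ = joinIrreducible-lift {j′} ji

        v≤v′ : card (↑? j ∩? ∁? M?) ≤ⁿ K.card (K.↑? j′)
        v≤v′ = card-injection L L∖M (↑? j ∩? ∁? M?) (K.↑? j′) (λ {x} {y} → K.≤-respʳ-≈ {j′} {x} {y})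
                 (λ (x , _ , ¬mx) → remaining (x , ¬mx)) (λ (_ , q) → ↑j∩∁M⊆↑j′ q) (λ e → e)
    -- Adding `card M?` to both sides avoids subtraction: it absorbs the bound from `small`.
    in ℕ.+-cancelˡ-< (card M?) _ _ (begin-strict
      card M? + K.size                                       ≡⟨ card-M+card-∁M ⟩
      size                                                   <⟨ proj₂ ce j jij ⟩
      2 * card (↑? j)                                        ≡⟨ cong (2 *_) (count-∩-∁ (↑? j) M? (tabulate from)) ⟩
      2 * (card (↑? j ∩? M?) + card (↑? j ∩? ∁? M?))         ≡⟨ ℕ.*-distribˡ-+ 2 (card (↑? j ∩? M?)) _ ⟩
      2 * card (↑? j ∩? M?) + 2 * card (↑? j ∩? ∁? M?)       ≤⟨ ℕ.+-mono-≤ (small j jij) (ℕ.*-monoʳ-≤ 2 v≤v′) ⟩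
      card M? + 2 * K.card (K.↑? j′)                         ∎)
    where open ℕ.≤-Reasoning

theorem2p9 : ∀ {c ℓ₁ ℓ₂ p : Level} (L : FiniteLattice c ℓ₁ ℓ₂) → MinimumCounterexample L →
    let open FiniteLattice L in
    (M : Pred Carrier p) (M? : Decidable M) → M Respects _≈_ →
    Satisfiable M → M ⊆ MeetIrreducible →
    ∃ λ j → JoinIrreducible j × (card M? < 2 * card (↑? j ∩? M?))
-- The conclusion is decidable by finite search, so refuting its negation yields an actual `j`.
theorem2p9 L (ce , minimum) M M? M-resp sat M⊆MI = decidable-stable
  (satisfiable? (λ j → joinIrreducible? j ×-dec (card M? ℕ.<? 2 * card (↑? j ∩? M?))) respects)
  λ none → minimum
    ( L∖M
    , L∖M-counterexample ce sat (λ j ji → ℕ.≮⇒≥ λ big → none (j , ji , big))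
    , card-∁M<size sat )
  where
  open FiniteLattice L
  open FiniteLatticeProperties L
  open Removal L M? M-resp M⊆MI

  respects : (λ j → JoinIrreducible j × card M? < 2 * card (↑? j ∩? M?)) Respects _≈_
  respects {i} {j} e (ji , big) = joinIrreducible-resp e ji , ℕ.<-≤-trans big (ℕ.*-monoʳ-≤ 2
    (card-mono L (↑? i ∩? M?) (↑? j ∩? M?)
      (λ e (p , m) → ≤-respʳ-≈ e p , M-resp e m)
      (λ (p , m) → ≤-respˡ-≈ e p , m)))
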